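{- Let $m\ge 1$ be an integer, let $x_1,\dots,x_m$ be elements of a commutative ring, and let $D_m(x_1,\dots,x_m)$ be the $m\times m$ matrix whose $(p,q)$ entry is $x_{\max(m+1-p,\,q)}$ for $1\le p,q\le m$. Then $$\det D_m(x_1,\dots,x_m)=\begin{cases}(-1)^{\frac{m}{2}}\prod_{i=1}^{m}(x_i-x_{i+1}), & \text{if } m \text{ is even},\\[2pt] (-1)^{\frac{m-1}{2}}\prod_{i=1}^{m}(x_i-x_{i+1}), & \text{if } m \text{ is odd},\end{cases}$$ where $x_{m+1}=0$.
   Context: The matrix is, explicitly, $$D_m(x_1,\dots,x_m)=\begin{pmatrix} x_m & x_m & \cdots & x_m & x_m\\ x_{m-1} & x_{m-1} & \cdots & x_{m-1} & x_m\\ \vdots&\vdots&\ddots&\vdots&\vdots\\ x_2 & x_2 & \cdots & x_{m-1} & x_m\\ x_1 & x_2&\cdots & x_{m-1} & x_m\end{pmatrix}.$$ -}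

module Defs where

open import Algebra.Bundles using (CommutativeRing; Semiring)
open import Data.Fin.Base using (Fin; zero; suc; toℕ; fromℕ; opposite)
open import Data.Fin.Properties using (≤-totalOrder)
open import Data.Nat.Base using (ℕ; zero; suc)
open import Data.Vec.Functional using (Vector; head; tail; removeAt; insertAt; map)
import Algebra.Construct.NaturalChoice.Max as Max
import Algebra.Definitions.RawSemiring as RawSemiringDefinitions

_⊔ᶠ_ : ∀ {n} → Fin n → Fin n → Fin n
_⊔ᶠ_ {n} = Max._⊔_ (≤-totalOrder n)

module Matrices {c ℓ} (R : CommutativeRing c ℓ) where

  open CommutativeRing R
  open RawSemiringDefinitions (Semiring.rawSemiring semiring) public using (_^_; sum; product)

  SquareMatrix : ℕ → Set c
  SquareMatrix n = Vector (Vector Carrier n) n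

  -- Cofactor expansion along the first row.  Numbering columns from 0 instead
  -- of 1 makes the sign (-1)^j, in place of (-1)^(1+j).
  det : ∀ {n} → SquareMatrix n → Carrier
  det {zero}  A = 1#
  det {suc n} A = sum λ j →
    (- 1#) ^ toℕ j * (head A j * det (map (λ row → removeAt row j) (tail A)))

  -- The vector x i represents x_{i+1}.  For the 0-based row index p,
  -- `opposite p` is m-1-p: the 0-based form of m+1-p for 1-based p.
  D : ∀ {m} → Vector Carrier m → SquareMatrix m
  D x p q = x (opposite p ⊔ᶠ q)

  -- x₁, …, xₘ, xₘ₊₁ with xₘ₊₁ = 0.
  extendByZero : ∀ {m} → Vector Carrier m → Vector Carrier (suc m)
  extendByZero {m} x = insertAt x (fromℕ m) 0#

{-# OPTIONS --safe #-}

-- Every row of D_m ends in x_m, so by linearity in the last column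
-- det D_m = x_m e_m, where e_m is the determinant of D_m with its last column
-- replaced by ones.  Deleting the first row of that matrix leaves D_{m-1}
-- followed by a column of ones; its last two columns are both constant, so only
-- the last two minors of the first row survive, and
--   e_m = (-1)^{m-1} (x_{m-1} - x_m) e_{m-1}.

module Submission where

open import Defs
open import Algebra.Bundles using (CommutativeRing)
open import Data.Fin.Base using (Fin; zero; suc; toℕ; fromℕ; inject₁; opposite; punchIn; _≤_)
open import Data.Fin.Properties
  using (≤-totalOrder; ≤-total; ≤fromℕ; toℕ-inject₁; toℕ-fromℕ)
open import Data.Fin.Relation.Unary.Top using (view; ‵fromℕ; ‵inject₁)
open import Data.Nat.Base as ℕ using (ℕ; zero; suc; _∸_; _/_; ⌊_/2⌋; z≤n; s≤s)
open import Data.Nat.Divisibility using (_∣_; _∤_; ∣-refl; ∣m∣n⇒∣m+n)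
open import Data.Nat.DivMod using (m/n≡1+[m∸n]/n)
open import Data.Product.Base using (_×_; _,_)
open import Data.Sum.Base using (inj₁; inj₂)
open import Data.Vec.Functional
  using (Vector; head; tail; init; last; removeAt; insertAt; map)
open import Data.Vec.Functional.Properties using (insertAt-lookup; removeAt-insertAt)
open import Function.Base using (_∘_)
open import Relation.Binary.PropositionalEquality.Core as ≡ using (_≡_; _≗_)
open import Relation.Nullary.Negation using (contradiction)
import Algebra.Construct.NaturalChoice.Max as Max

private
  variable
    m n : ℕ

-- Halving and parity of the exponents.

n/2≡⌊n/2⌋ : ∀ n → n / 2 ≡ ⌊ n /2⌋
n/2≡⌊n/2⌋ zero          = ≡.refl
n/2≡⌊n/2⌋ (suc zero)    = ≡.refl
n/2≡⌊n/2⌋ (suc (suc n)) =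
  ≡.trans (m/n≡1+[m∸n]/n {suc (suc n)} (s≤s (s≤s z≤n))) (≡.cong suc (n/2≡⌊n/2⌋ n))

-- Makes the exponent `(m - 1) / 2` of the odd case another form of `⌊ m /2⌋`, so that a single
-- determinant formula serves both parities.
2∤1+n⇒⌊n/2⌋≡⌊1+n/2⌋ : ∀ n → 2 ∤ suc n → ⌊ n /2⌋ ≡ ⌊ suc n /2⌋
2∤1+n⇒⌊n/2⌋≡⌊1+n/2⌋ zero          _     = ≡.refl
2∤1+n⇒⌊n/2⌋≡⌊1+n/2⌋ (suc zero)    2∤2   = contradiction ∣-refl 2∤2
2∤1+n⇒⌊n/2⌋≡⌊1+n/2⌋ (suc (suc n)) 2∤3+n =
  ≡.cong suc (2∤1+n⇒⌊n/2⌋≡⌊1+n/2⌋ n (2∤3+n ∘ ∣m∣n⇒∣m+n ∣-refl))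

-- Maxima of indices.

x≤y⇒x⊔ᶠy≡y : {i j : Fin n} → i ≤ j → i ⊔ᶠ j ≡ j
x≤y⇒x⊔ᶠy≡y {n} = Max.x≤y⇒x⊔y≈y (≤-totalOrder n)

x≤y⇒y⊔ᶠx≡y : {i j : Fin n} → i ≤ j → j ⊔ᶠ i ≡ j
x≤y⇒y⊔ᶠx≡y {n} = Max.x≤y⇒y⊔x≈y (≤-totalOrder n)

inject₁-mono-≤ : {i j : Fin n} → i ≤ j → inject₁ i ≤ inject₁ j
inject₁-mono-≤ {i = i} {j} = ≡.subst₂ ℕ._≤_ (≡.sym (toℕ-inject₁ i)) (≡.sym (toℕ-inject₁ j))

-- A monotone map between total orders preserves maxima. This is what lets the entries of a smaller
-- `D` be recognised inside a larger one.
inject₁-⊔ᶠ : (i j : Fin n) → inject₁ i ⊔ᶠ inject₁ j ≡ inject₁ (i ⊔ᶠ j)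
inject₁-⊔ᶠ i j with ≤-total i j
... | inj₁ i≤j =
  ≡.trans (x≤y⇒x⊔ᶠy≡y (inject₁-mono-≤ i≤j)) (≡.cong inject₁ (≡.sym (x≤y⇒x⊔ᶠy≡y i≤j)))
... | inj₂ j≤i =
  ≡.trans (x≤y⇒y⊔ᶠx≡y (inject₁-mono-≤ j≤i)) (≡.cong inject₁ (≡.sym (x≤y⇒y⊔ᶠx≡y j≤i)))

-- Vectors with an appended last entry.

module _ {a} {A : Set a} where

  infixl 5 _∷ʳ_

  -- Written with `insertAt` so that `extendByZero x` is `x ∷ʳ 0#` by definition.
  _∷ʳ_ : Vector A n → A → Vector A (suc n)
  xs ∷ʳ x = insertAt xs (fromℕ _) x

  ∷ʳ-inject₁ : (xs : Vector A n) (x : A) → init (xs ∷ʳ x) ≗ xs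
  ∷ʳ-inject₁ xs x zero    = ≡.refl
  ∷ʳ-inject₁ xs x (suc i) = ∷ʳ-inject₁ (tail xs) x i

  ∷ʳ-last : (xs : Vector A n) (x : A) → last (xs ∷ʳ x) ≡ x
  ∷ʳ-last xs = insertAt-lookup xs (fromℕ _)

  ∷ʳ-cong : {xs ys : Vector A n} → xs ≗ ys → (x : A) → xs ∷ʳ x ≗ ys ∷ʳ x
  ∷ʳ-cong {zero}  xs≗ys x zero    = ≡.refl
  ∷ʳ-cong {suc n} xs≗ys x zero    = xs≗ys zero
  ∷ʳ-cong {suc n} xs≗ys x (suc i) = ∷ʳ-cong (xs≗ys ∘ suc) x i

  init-∷ʳ-last : (xs : Vector A (suc n)) → xs ≗ init xs ∷ʳ last xs
  init-∷ʳ-last {zero}  xs zero    = ≡.refl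
  init-∷ʳ-last {suc n} xs zero    = ≡.refl
  init-∷ʳ-last {suc n} xs (suc i) = init-∷ʳ-last (tail xs) i

  removeAt-last-∷ʳ : (xs : Vector A n) (x : A) → removeAt (xs ∷ʳ x) (fromℕ n) ≗ xs
  removeAt-last-∷ʳ xs = removeAt-insertAt xs (fromℕ _)

  removeAt-inject₁-∷ʳ : (xs : Vector A (suc n)) (x : A) (i : Fin (suc n)) →
    removeAt (xs ∷ʳ x) (inject₁ i) ≗ removeAt xs i ∷ʳ x
  removeAt-inject₁-∷ʳ         xs x zero    j       = ≡.refl
  removeAt-inject₁-∷ʳ {suc n} xs x (suc i) zero    = ≡.refl
  removeAt-inject₁-∷ʳ {suc n} xs x (suc i) (suc j) = removeAt-inject₁-∷ʳ (tail xs) x i j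

module Determinants {c ℓ} (R : CommutativeRing c ℓ) where

  open CommutativeRing R hiding (zero)
  open Matrices R
  open import Algebra.Properties.Ring ring using (-0#≈0#; -1*x≈-x; -‿involutive)
  open import Algebra.Properties.Monoid.Sum +-monoid
    using (sum-cong-≋; sum-init-last; sum-replicate-zero)
  open import Algebra.Properties.Monoid.Sum *-monoid
    using () renaming (sum-cong-≋ to product-cong-≋; sum-init-last to product-init-last)
  open import Algebra.Properties.Semiring.Sum semiring using (*-distribˡ-sum)
  open import Algebra.Properties.CommutativeSemigroup *-commutativeSemigroup
    using (x∙yz≈y∙xz)
  open import Algebra.Solver.Ring.NaturalCoefficients.Default commutativeSemiring
    using (solve; _:+_; _:*_; _:=_)
  open import Relation.Binary.Reasoning.Setoid setoid

  -- Signs and congruence of determinants.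

  Matrix : ℕ → ℕ → Set c
  Matrix m n = Vector (Vector Carrier n) m

  ε : ℕ → Carrier
  ε n = (- 1#) ^ n

  -1*-1≈1 : - 1# * - 1# ≈ 1#
  -1*-1≈1 = trans (-1*x≈-x (- 1#)) (-‿involutive 1#)

  -- The exponents on the two sides have the same parity: when `n` grows by 2, the left one grows by
  -- 3 and the right one by 1. This collects the signs produced by the recursion for `e_m`.
  ε-⌊/2⌋ : ∀ n → ε n * ε ⌊ n /2⌋ ≈ ε ⌊ suc n /2⌋
  ε-⌊/2⌋ zero          = *-identityˡ 1#
  ε-⌊/2⌋ (suc zero)    = *-identityʳ (- 1# * 1#)
  ε-⌊/2⌋ (suc (suc n)) = begin
    (s * (s * ε n)) * (s * ε ⌊ n /2⌋)  ≈⟨ solve 3 (λ s p q →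
      (s :* (s :* p)) :* (s :* q) := (s :* s) :* (s :* (p :* q))) refl s (ε n) (ε ⌊ n /2⌋) ⟩
    (s * s) * (s * (ε n * ε ⌊ n /2⌋))  ≈⟨ *-cong -1*-1≈1 (*-congˡ (ε-⌊/2⌋ n)) ⟩
    1# * (s * ε ⌊ suc n /2⌋)           ≈⟨ *-identityˡ _ ⟩
    s * ε ⌊ suc n /2⌋                  ∎
    where s = - 1#

  det-cong : {A B : SquareMatrix n} → (∀ p q → A p q ≈ B p q) → det A ≈ det B
  det-cong {zero}  A≈B = refl
  det-cong {suc n} A≈B = sum-cong-≋ λ j →
    *-congˡ {ε (toℕ j)} (*-cong (A≈B zero j) (det-cong λ p q → A≈B (suc p) (punchIn j q)))

  det-cong-≗ : {A B : SquareMatrix n} → (∀ p → A p ≗ B p) → det A ≈ det B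
  det-cong-≗ A≗B = det-cong λ p q → reflexive (A≗B p q)

  removeColumn : Fin (suc n) → Matrix m (suc n) → Matrix m n
  removeColumn j = map (λ row → removeAt row j)

  -- Determinants whose last one or two columns are constant.

  infixl 5 _▷_

  _▷_ : Matrix m n → Carrier → Matrix m (suc n)
  (A ▷ a) p = A p ∷ʳ a

  removeColumn-last-▷ : (A : Matrix m n) (a : Carrier) →
    ∀ p → removeColumn (fromℕ n) (A ▷ a) p ≗ A p
  removeColumn-last-▷ A a p = removeAt-last-∷ʳ (A p) a

  removeColumn-inject₁-▷ : (A : Matrix m (suc n)) (a : Carrier) (j : Fin (suc n)) →
    ∀ p → removeColumn (inject₁ j) (A ▷ a) p ≗ (removeColumn j A ▷ a) p
  removeColumn-inject₁-▷ A a j p = removeAt-inject₁-∷ʳ (A p) a j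

  cofactorTerm : SquareMatrix (suc n) → Vector Carrier (suc n)
  cofactorTerm A j = ε (toℕ j) * (head A j * det (removeColumn j (tail A)))

  -- Expand along the first row. In the last term the appended column contributes only its top
  -- entry, which is `a`; every other minor still ends in the constant column and yields `a` by the
  -- mutual induction with `det-removeColumn-▷`.
  det-▷ : (A : Matrix (suc n) n) (a : Carrier) → det (A ▷ a) ≈ a * det (A ▷ 1#)

  -- Deleting an earlier column commutes with appending the last one, so the minor is again of the
  -- form treated by `det-▷`, one size smaller.
  det-removeColumn-▷ : (A : Matrix n n) (a : Carrier) (j : Fin n) →
    det (removeColumn (inject₁ j) (A ▷ a)) ≈ a * det (removeColumn (inject₁ j) (A ▷ 1#))
  det-removeColumn-▷ {suc n} A a j = begin
    det (removeColumn (inject₁ j) (A ▷ a))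
      ≈⟨ det-cong-≗ (removeColumn-inject₁-▷ A a j) ⟩
    det (removeColumn j A ▷ a)
      ≈⟨ det-▷ (removeColumn j A) a ⟩
    a * det (removeColumn j A ▷ 1#)
      ≈⟨ *-congˡ (det-cong-≗ (removeColumn-inject₁-▷ A 1# j)) ⟨
    a * det (removeColumn (inject₁ j) (A ▷ 1#)) ∎

  det-▷ {n} A a = begin
    sum (cofactorTerm (A ▷ a))                ≈⟨ sum-cong-≋ linear ⟩
    sum (λ j → a * cofactorTerm (A ▷ 1#) j)   ≈⟨ *-distribˡ-sum a (cofactorTerm (A ▷ 1#)) ⟨
    a * sum (cofactorTerm (A ▷ 1#))           ∎
    where
    minor : Carrier → Fin (suc n) → Carrier
    minor b j = det (removeColumn j (tail A ▷ b))

    linear : ∀ j → cofactorTerm (A ▷ a) j ≈ a * cofactorTerm (A ▷ 1#) j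
    linear j with view j
    ... | ‵fromℕ = begin
      ε k * ((head A ∷ʳ a) j * minor a j)       ≈⟨ *-congˡ (last-term a) ⟩
      ε k * (a * det (tail A))                  ≈⟨ x∙yz≈y∙xz (ε k) a _ ⟩
      a * (ε k * det (tail A))                  ≈⟨ *-congˡ (*-congˡ (*-identityˡ _)) ⟨
      a * (ε k * (1# * det (tail A)))           ≈⟨ *-congˡ (*-congˡ (last-term 1#)) ⟨
      a * (ε k * ((head A ∷ʳ 1#) j * minor 1# j)) ∎
      where
      k = toℕ j
      last-term : ∀ b → (head A ∷ʳ b) (fromℕ n) * minor b (fromℕ n) ≈ b * det (tail A)
      last-term b = *-cong
        (reflexive (∷ʳ-last (head A) b))
        (det-cong-≗ (removeColumn-last-▷ (tail A) b))
    ... | ‵inject₁ i = begin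
      ε k * ((head A ∷ʳ a) j * minor a j)       ≈⟨ *-congˡ (*-cong (reflexive same-entry) (det-removeColumn-▷ (tail A) a i)) ⟩
      ε k * (h * (a * minor 1# j))              ≈⟨ *-congˡ (x∙yz≈y∙xz h a _) ⟩
      ε k * (a * (h * minor 1# j))              ≈⟨ x∙yz≈y∙xz (ε k) a _ ⟩
      a * (ε k * (h * minor 1# j))              ∎
      where
      k = toℕ j
      h = (head A ∷ʳ 1#) j
      same-entry : (head A ∷ʳ a) j ≡ h
      same-entry = ≡.trans (∷ʳ-inject₁ (head A) a i) (≡.sym (∷ʳ-inject₁ (head A) 1# i))

  -- Minors of the first row that keep both constant columns vanish.
  det-tail-▷▷ : (A : SquareMatrix (suc (suc n))) (C : Matrix (suc n) n) (u v : Carrier) →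
    (∀ p → tail A p ≗ (C ▷ u ▷ v) p) →
    det A ≈ ε n * (init (head A) (fromℕ n) * det (C ▷ v))
          + ε (suc n) * (last (head A) * det (C ▷ u))

  -- The last two columns are proportional. Of the first-row expansion two terms survive; pulling
  -- `u` or `v` out of the remaining constant column makes them equal up to opposite signs.
  det-▷▷ : (C : Matrix (suc (suc n)) n) (u v : Carrier) → det (C ▷ u ▷ v) ≈ 0#
  det-▷▷ {n} C u v = begin
    det (C ▷ u ▷ v)
      ≈⟨ det-tail-▷▷ (C ▷ u ▷ v) (tail C) u v (λ _ _ → ≡.refl) ⟩
    ε n * (init (head C ∷ʳ u ∷ʳ v) (fromℕ n) * det (tail C ▷ v))
      + ε (suc n) * (last (head C ∷ʳ u ∷ʳ v) * det (tail C ▷ u))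
      ≈⟨ +-cong
           (*-congˡ (*-cong (reflexive penultimate-entry) (det-▷ (tail C) v)))
           (*-congˡ (*-cong (reflexive (∷ʳ-last (head C ∷ʳ u) v)) (det-▷ (tail C) u))) ⟩
    ε n * (u * (v * d)) + (- 1# * ε n) * (v * (u * d))
      -- `- 1#` enters as an indeterminate `o`, so that the second term becomes `- 1#` times the
      -- first.
      ≈⟨ solve 5 (λ o e u v d → e :* (u :* (v :* d)) :+ (o :* e) :* (v :* (u :* d))
                             := e :* (u :* (v :* d)) :+ o :* (e :* (u :* (v :* d))))
           refl (- 1#) (ε n) u v d ⟩
    w + - 1# * w  ≈⟨ +-congˡ (-1*x≈-x w) ⟩
    w - w         ≈⟨ -‿inverseʳ w ⟩
    0#            ∎
    where
    d = det (tail C ▷ 1#)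
    w = ε n * (u * (v * d))
    penultimate-entry : init (head C ∷ʳ u ∷ʳ v) (fromℕ n) ≡ u
    penultimate-entry = ≡.trans (∷ʳ-inject₁ (head C ∷ʳ u) v (fromℕ n)) (∷ʳ-last (head C) u)

  -- Both constant columns survive the deletion, so `det-▷▷` applies. The size drops here, which
  -- makes the mutual recursion with `det-tail-▷▷` terminate.
  det-removeColumn-▷▷ : (C : Matrix (suc n) n) (u v : Carrier) (j : Fin n) →
    det (removeColumn (inject₁ (inject₁ j)) (C ▷ u ▷ v)) ≈ 0#
  det-removeColumn-▷▷ {suc n} C u v j = trans
    (det-cong-≗ λ p q → ≡.trans
      (removeColumn-inject₁-▷ (C ▷ u) v (inject₁ j) p q)
      (∷ʳ-cong (removeColumn-inject₁-▷ C u j p) v q))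
    (det-▷▷ (removeColumn j C) u v)

  det-tail-▷▷ {n} A C u v tailA≗ = begin
    sum t
      ≈⟨ sum-init-last t ⟩
    sum (init t) + last t
      ≈⟨ +-congʳ (sum-init-last (init t)) ⟩
    sum (init (init t)) + last (init t) + last t
      ≈⟨ +-cong (+-cong (trans (sum-cong-≋ vanishing) (sum-replicate-zero n)) penultimate) ultimate ⟩
    0# + ε n * (init (head A) (fromℕ n) * det (C ▷ v)) + ε (suc n) * (last (head A) * det (C ▷ u))
      ≈⟨ +-congʳ (+-identityˡ _) ⟩
    ε n * (init (head A) (fromℕ n) * det (C ▷ v)) + ε (suc n) * (last (head A) * det (C ▷ u)) ∎
    where
    t = cofactorTerm A

    minor : ∀ j → det (removeColumn j (tail A)) ≈ det (removeColumn j (C ▷ u ▷ v))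
    minor j = det-cong-≗ λ p q → tailA≗ p (punchIn j q)

    vanishing : ∀ j → init (init t) j ≈ 0#
    vanishing j = trans
      (*-congˡ (trans (*-congˡ (trans (minor _) (det-removeColumn-▷▷ C u v j))) (zeroʳ _)))
      (zeroʳ _)

    -- Deleting the column of `u` leaves the column of `v` as the border, and conversely in
    -- `ultimate`.
    penultimate : last (init t) ≈ ε n * (init (head A) (fromℕ n) * det (C ▷ v))
    penultimate = *-cong
      (reflexive (≡.cong ε (≡.trans (toℕ-inject₁ (fromℕ n)) (toℕ-fromℕ n))))
      (*-congˡ (trans (minor _) (det-cong-≗ λ p q → ≡.trans
        (removeColumn-inject₁-▷ (C ▷ u) v (fromℕ n) p q)
        (∷ʳ-cong (removeColumn-last-▷ C u p) v q))))

    ultimate : last t ≈ ε (suc n) * (last (head A) * det (C ▷ u))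
    ultimate = *-cong
      (reflexive (≡.cong ε (toℕ-fromℕ (suc n))))
      (*-congˡ (trans (minor _) (det-cong-≗ (removeColumn-last-▷ (C ▷ u) v))))

  -- The matrix `D x` and its recursion.

  D-first-row : (x : Vector Carrier (suc n)) → ∀ q → D x zero q ≡ last x
  D-first-row x q = ≡.cong x (x≤y⇒y⊔ᶠx≡y (≤fromℕ q))

  D-last-column : (x : Vector Carrier (suc n)) → ∀ p → last (D x p) ≡ last x
  D-last-column x p = ≡.cong x (x≤y⇒x⊔ᶠy≡y (≤fromℕ (opposite p)))

  -- `opposite (suc p)` reduces to `inject₁ (opposite p)`, so the maximum is taken over two injected
  -- indices and never reaches the top one.
  D-init : (x : Vector Carrier (suc n)) → ∀ p → init (D x (suc p)) ≗ D (init x) p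
  D-init x p q = ≡.cong x (inject₁-⊔ᶠ (opposite p) q)

  initColumns : Matrix m (suc n) → Matrix m n
  initColumns A p = init (A p)

  D-▷ : (x : Vector Carrier (suc n)) → ∀ p → D x p ≗ (initColumns (D x) ▷ last x) p
  D-▷ x p q = ≡.trans (init-∷ʳ-last (D x p) q)
    (≡.cong (λ a → (init (D x p) ∷ʳ a) q) (D-last-column x p))

  consecutiveDifferences : Vector Carrier (suc n) → Vector Carrier n
  consecutiveDifferences x i = x (inject₁ i) - x (suc i)

  -- This is `e_m` with `m = n + 1`.
  unitBorderedDet : Vector Carrier (suc n) → Carrier
  unitBorderedDet x = det (initColumns (D x) ▷ 1#)

  unitBorderedDet-step : (x : Vector Carrier (suc (suc n))) →
    unitBorderedDet x ≈ ε (suc n) * ((last (init x) - last x) * unitBorderedDet (init x))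
  unitBorderedDet-step {n} x = begin
    unitBorderedDet x
      -- Below the first row stands `D (init x)` followed by ones. Its own last column is constantly
      -- `a`, so the two constant columns have values `a` and `1#`.
      ≈⟨ det-tail-▷▷ (initColumns (D x) ▷ 1#) (initColumns (D (init x))) a 1#
           (λ p → ∷ʳ-cong (λ q → ≡.trans (D-init x p q) (D-▷ (init x) p q)) 1#) ⟩
    ε n * (init (init (D x zero) ∷ʳ 1#) (fromℕ n) * d)
      + ε (suc n) * (last (init (D x zero) ∷ʳ 1#) * det (initColumns (D (init x)) ▷ a))
      ≈⟨ +-cong
           (*-congˡ (*-congʳ (reflexive penultimate-entry)))
           (*-congˡ (*-cong (reflexive (∷ʳ-last (init (D x zero)) 1#)) (det-▷ (initColumns (D (init x))) a))) ⟩
    ε n * (b * d) + ε (suc n) * (1# * (a * d))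
      -- Inserting `s * s`, which equals `1#`, into the first term gives both terms the common
      -- factor `ε (suc n)`.
      ≈⟨ +-cong (*-congʳ (trans (sym (*-identityˡ _)) (*-congʳ (sym -1*-1≈1)))) (*-congˡ (*-identityˡ _)) ⟩
    ((s * s) * ε n) * (b * d) + (s * ε n) * (a * d)
      ≈⟨ solve 5 (λ s e a b d → ((s :* s) :* e) :* (b :* d) :+ (s :* e) :* (a :* d)
                             := (s :* e) :* ((a :+ s :* b) :* d)) refl s (ε n) a b d ⟩
    ε (suc n) * ((a + s * b) * d)
      ≈⟨ *-congˡ (*-congʳ (+-congˡ (-1*x≈-x b))) ⟩
    ε (suc n) * ((a - b) * d) ∎
    where
    s = - 1#
    a = last (init x)
    b = last x
    d = unitBorderedDet (init x)
    penultimate-entry : init (init (D x zero) ∷ʳ 1#) (fromℕ n) ≡ b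
    penultimate-entry = ≡.trans
      (∷ʳ-inject₁ (init (D x zero)) 1# (fromℕ n))
      (D-first-row x (inject₁ (fromℕ n)))

  -- Each step of the recursion splits off the last difference `δ`, and `ε-⌊/2⌋` merges its sign
  -- with the sign accumulated so far.
  unitBorderedDet≈ : (x : Vector Carrier (suc n)) →
    unitBorderedDet x ≈ ε ⌊ suc n /2⌋ * product (consecutiveDifferences x)
  unitBorderedDet≈ {zero}  x = trans (+-identityʳ _) (*-congˡ (*-identityʳ 1#))
  unitBorderedDet≈ {suc n} x = begin
    unitBorderedDet x
      ≈⟨ unitBorderedDet-step x ⟩
    ε (suc n) * (δ * unitBorderedDet (init x))
      ≈⟨ *-congˡ (*-congˡ (unitBorderedDet≈ (init x))) ⟩
    ε (suc n) * (δ * (ε ⌊ suc n /2⌋ * π))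
      ≈⟨ solve 4 (λ e δ f π → e :* (δ :* (f :* π)) := (e :* f) :* (π :* δ))
           refl (ε (suc n)) δ (ε ⌊ suc n /2⌋) π ⟩
    (ε (suc n) * ε ⌊ suc n /2⌋) * (π * δ)
      -- `init (consecutiveDifferences x)` is `consecutiveDifferences (init x)` by definition, hence
      -- `π` is the product of all differences but the last.
      ≈⟨ *-cong (ε-⌊/2⌋ (suc n)) (sym (product-init-last (consecutiveDifferences x))) ⟩
    ε ⌊ suc (suc n) /2⌋ * product (consecutiveDifferences x) ∎
    where
    δ = last (init x) - last x
    π = product (consecutiveDifferences (init x))

  -- The appended zero makes the last difference `last x - 0#`. Thus the factor pulled out of the
  -- last column of `D x` becomes the final factor of the product.
  product-extendByZero : (x : Vector Carrier (suc n)) →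
    product (consecutiveDifferences (extendByZero x)) ≈ product (consecutiveDifferences x) * last x
  product-extendByZero {n} x = begin
    product (consecutiveDifferences y)
      ≈⟨ product-init-last (consecutiveDifferences y) ⟩
    product (init (consecutiveDifferences y)) * (init y (fromℕ n) - last y)
      ≈⟨ *-cong
           (product-cong-≋ λ i →
             reflexive (≡.cong₂ _-_ (∷ʳ-inject₁ x 0# (inject₁ i)) (∷ʳ-inject₁ x 0# (suc i))))
           (reflexive (≡.cong₂ _-_ (∷ʳ-inject₁ x 0# (fromℕ n)) (∷ʳ-last x 0#))) ⟩
    product (consecutiveDifferences x) * (last x - 0#)
      ≈⟨ *-congˡ (trans (+-congˡ -0#≈0#) (+-identityʳ _)) ⟩
    product (consecutiveDifferences x) * last x ∎
    where y = extendByZero x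

  det-D : (x : Vector Carrier (suc n)) →
    det (D x) ≈ ε ⌊ suc n /2⌋ * product (consecutiveDifferences (extendByZero x))
  det-D {n} x = begin
    det (D x)
      ≈⟨ det-cong-≗ (D-▷ x) ⟩
    det (initColumns (D x) ▷ last x)
      ≈⟨ det-▷ (initColumns (D x)) (last x) ⟩
    last x * unitBorderedDet x
      ≈⟨ *-comm (last x) _ ⟩
    unitBorderedDet x * last x
      ≈⟨ *-congʳ (unitBorderedDet≈ x) ⟩
    ε ⌊ suc n /2⌋ * product (consecutiveDifferences x) * last x
      ≈⟨ *-assoc _ _ _ ⟩
    ε ⌊ suc n /2⌋ * (product (consecutiveDifferences x) * last x)
      ≈⟨ *-congˡ (product-extendByZero x) ⟨
    ε ⌊ suc n /2⌋ * product (consecutiveDifferences (extendByZero x)) ∎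

proposition1p4 : ∀ {c ℓ} (R : CommutativeRing c ℓ) →
    let open CommutativeRing R
        open Matrices R in
    (m : ℕ) → 1 ℕ.≤ m → (x : Vector Carrier m) →
    (2 ∣ m → det (D x) ≈ (- 1#) ^ (m / 2) * product (λ i → extendByZero x (inject₁ i) - extendByZero x (suc i))) ×
    (2 ∤ m → det (D x) ≈ (- 1#) ^ ((m ∸ 1) / 2) * product (λ i → extendByZero x (inject₁ i) - extendByZero x (suc i)))
proposition1p4 R (suc n) _ x =
    -- Both cases are `det-D` with its exponent `⌊ m /2⌋` rewritten; in the odd case `m ∸ 1` reduces
    -- to `n`.
    (λ _   → exponent (≡.sym (n/2≡⌊n/2⌋ (suc n))))
  , (λ 2∤m → exponent (≡.sym (≡.trans (n/2≡⌊n/2⌋ n) (2∤1+n⇒⌊n/2⌋≡⌊1+n/2⌋ n 2∤m))))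
  where
  open CommutativeRing R
  open Matrices R
  open Determinants R

  exponent : ∀ {k} → ⌊ suc n /2⌋ ≡ k →
    det (D x) ≈ ε k * product (consecutiveDifferences (extendByZero x))
  exponent ⌊m/2⌋≡k = trans (det-D x) (*-congʳ (reflexive (≡.cong ε ⌊m/2⌋≡k)))
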